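{- Consider the single-player pile game with boundary with set of choices $R=\{2,-1\}$ (probability $p$ of $+2$ and $q=1-p$ of $-1$), with generating functions $G_{n,s}(x)$, $0\le s\le n$. Write $G_{n,s}(x)=\dfrac{N_{n,s}(x)}{D_n(x)}$ for $0\le s\le n$, where $N_{n,s}(x)$ are polynomials and $D_n(x)$ is the common denominator, with constant term $1$, arising from solving the linear system for the $G_{n,s}(x)$ (as specified in the context). Then $D_n(x)$, as a sequence in $n$, satisfies $$D_n(x)=D_{n-1}(x)-p\,q^2x^3\,D_{n-3}(x)\qquad(n\ge3).$$
   Context: Single-player pile game with boundary, $R=\{2,-1\}$: the player starts with $s\ge0$ chips. In each turn, independently, the number of chips $c$ is replaced by $c+2$ with probability $p$ and by $\max(0,c-1)$ with probability $q=1-p$. The game ends when the player first has $n$ chips or more (at turn $0$ if $s\ge n$). $B_n(k,s)$ is the probability that the game ends at the $k$-th turn, and $G_{n,s}(x)=\sum_{k\ge0}B_n(k,s)x^k$. These functions satisfy the linear system $G_{n,0}=pxG_{n,2}+qxG_{n,0}$, $G_{n,s}=pxG_{n,s+2}+qxG_{n,s-1}$ for $1\le s<n$, with $G_{n,s}=1$ for $s\ge n$. Writing it as a system in the $n$ unknowns $G_{n,0},\dots,G_{n,n-1}$ with coefficient matrix $I-xM_n$, where $M_n$ is the matrix of one-step transition probabilities among the states $0,\dots,n-1$, Cramer's rule gives the common denominator $D_n(x)=\det(I-xM_n)$, which has constant term $1$ (and $D_0(x)=1$). -}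

module Defs where

open import Algebra.Bundles using (CommutativeRing)
import Algebra.Construct.Pointwise as Pointwise
import Algebra.Definitions.RawMonoid as RawMonoidDefinitions
import Algebra.Properties.Semiring.Exp as Exponentiation
open import Data.Bool.Base using (Bool; _∧_; if_then_else_)
open import Data.Fin.Base using (Fin; zero; suc; toℕ; punchIn)
import Data.Fin.Properties as Fin
open import Data.Nat.Base using (ℕ; zero; suc; _∸_; _≤_; _≤ᵇ_; _<ᵇ_; _≡ᵇ_)
  renaming (_+_ to _+ℕ_)
open import Data.Product.Base using (∃; _,_)
open import Data.Vec.Base using (Vec; []; _∷_; head)
open import Data.Vec.Functional using (Vector)
open import Function.Base using (_∘_)
import Relation.Binary.Reasoning.Setoid as SetoidReasoning
open import Relation.Nullary.Decidable.Core using (does)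

module FormalPowerSeries {c ℓ} (R : CommutativeRing c ℓ) where

  open CommutativeRing R hiding (zero)
  open RawMonoidDefinitions +-rawMonoid using (sum)
  open SetoidReasoning setoid
  private module P = Pointwise ℕ

  -- f k is the coefficient of x ^ k.
  PowerSeries : Set c
  PowerSeries = ℕ → Carrier

  infix  4 _≋_
  infixl 6 _⊕_
  infixl 7 _⊛_
  infix  8 ⊖_

  _≋_ : PowerSeries → PowerSeries → Set ℓ
  f ≋ g = ∀ k → f k ≈ g k

  _⊕_ : PowerSeries → PowerSeries → PowerSeries
  (f ⊕ g) k = f k + g k

  ⊖_ : PowerSeries → PowerSeries
  (⊖ f) k = - f k

  _⊛_ : PowerSeries → PowerSeries → PowerSeries
  (f ⊛ g) k = sum {suc k} (λ i → f (toℕ i) * g (k ∸ toℕ i))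

  C : Carrier → PowerSeries
  C a zero    = a
  C a (suc _) = 0#

  X : PowerSeries
  X zero          = 0#
  X (suc zero)    = 1#
  X (suc (suc _)) = 0#

  IsPolynomial : PowerSeries → Set ℓ
  IsPolynomial f = ∃ λ d → ∀ k → d ≤ k → f k ≈ 0#

  private
    tl : PowerSeries → PowerSeries
    tl f = f ∘ suc

    scale : Carrier → PowerSeries → PowerSeries
    scale a f k = a * f k

    interchange : ∀ a b c d → (a + b) + (c + d) ≈ (a + c) + (b + d)
    interchange a b c d = begin
      (a + b) + (c + d)  ≈⟨ +-assoc a b (c + d) ⟩
      a + (b + (c + d))  ≈⟨ +-congˡ (+-assoc b c d) ⟨
      a + ((b + c) + d)  ≈⟨ +-congˡ (+-congʳ (+-comm b c)) ⟩
      a + ((c + b) + d)  ≈⟨ +-congˡ (+-assoc c b d) ⟩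
      a + (c + (b + d))  ≈⟨ +-assoc a c (b + d) ⟨
      (a + c) + (b + d)  ∎

    cong-at : ∀ k {f f′ g g′} → f ≋ f′ → g ≋ g′ → (f ⊛ g) k ≈ (f′ ⊛ g′) k
    cong-at zero    f≋ g≋ = +-congʳ (*-cong (f≋ 0) (g≋ 0))
    cong-at (suc k) f≋ g≋ =
      +-cong (*-cong (f≋ 0) (g≋ (suc k))) (cong-at k (f≋ ∘ suc) g≋)

    zeroˡ-at : ∀ k g → ((λ _ → 0#) ⊛ g) k ≈ 0#
    zeroˡ-at zero    g = trans (+-identityʳ _) (zeroˡ _)
    zeroˡ-at (suc k) g = trans (+-cong (zeroˡ _) (zeroˡ-at k g)) (+-identityʳ 0#)

    distribʳ-at : ∀ k h f g → ((f ⊕ g) ⊛ h) k ≈ (f ⊛ h) k + (g ⊛ h) k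
    distribʳ-at zero h f g = begin
      (f 0 + g 0) * h 0 + 0#                ≈⟨ +-cong (distribʳ _ _ _) (sym (+-identityʳ 0#)) ⟩
      (f 0 * h 0 + g 0 * h 0) + (0# + 0#)   ≈⟨ interchange _ _ _ _ ⟩
      (f 0 * h 0 + 0#) + (g 0 * h 0 + 0#)   ∎
    distribʳ-at (suc k) h f g = begin
      (f 0 + g 0) * h (suc k) + ((tl f ⊕ tl g) ⊛ h) k
        ≈⟨ +-cong (distribʳ _ _ _) (distribʳ-at k h (tl f) (tl g)) ⟩
      (f 0 * h (suc k) + g 0 * h (suc k)) + ((tl f ⊛ h) k + (tl g ⊛ h) k)
        ≈⟨ interchange _ _ _ _ ⟩
      (f 0 * h (suc k) + (tl f ⊛ h) k) + (g 0 * h (suc k) + (tl g ⊛ h) k)  ∎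

    scale-at : ∀ k a f g → (scale a f ⊛ g) k ≈ a * (f ⊛ g) k
    scale-at zero a f g = begin
      (a * f 0) * g 0 + 0#   ≈⟨ +-identityʳ _ ⟩
      (a * f 0) * g 0        ≈⟨ *-assoc _ _ _ ⟩
      a * (f 0 * g 0)        ≈⟨ *-congˡ (+-identityʳ _) ⟨
      a * (f 0 * g 0 + 0#)   ∎
    scale-at (suc k) a f g = begin
      (a * f 0) * g (suc k) + (scale a (tl f) ⊛ g) k
        ≈⟨ +-cong (*-assoc _ _ _) (scale-at k a (tl f) g) ⟩
      a * (f 0 * g (suc k)) + a * (tl f ⊛ g) k
        ≈⟨ distribˡ _ _ _ ⟨
      a * (f 0 * g (suc k) + (tl f ⊛ g) k)  ∎

    assoc-at : ∀ k f g h → ((f ⊛ g) ⊛ h) k ≈ (f ⊛ (g ⊛ h)) k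
    assoc-at zero f g h = begin
      (f 0 * g 0 + 0#) * h 0 + 0#   ≈⟨ +-congʳ (*-congʳ (+-identityʳ _)) ⟩
      (f 0 * g 0) * h 0 + 0#        ≈⟨ +-congʳ (*-assoc _ _ _) ⟩
      f 0 * (g 0 * h 0) + 0#        ≈⟨ +-congʳ (*-congˡ (+-identityʳ _)) ⟨
      f 0 * (g 0 * h 0 + 0#) + 0#   ∎
    assoc-at (suc k) f g h = begin
      (f 0 * g 0 + 0#) * h (suc k) + ((scale (f 0) (tl g) ⊕ (tl f ⊛ g)) ⊛ h) k
        ≈⟨ +-cong (trans (*-congʳ (+-identityʳ _)) (*-assoc _ _ _))
                  (distribʳ-at k h (scale (f 0) (tl g)) (tl f ⊛ g)) ⟩
      f 0 * (g 0 * h (suc k)) + ((scale (f 0) (tl g) ⊛ h) k + ((tl f ⊛ g) ⊛ h) k)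
        ≈⟨ +-congˡ (+-cong (scale-at k (f 0) (tl g) h) (assoc-at k (tl f) g h)) ⟩
      f 0 * (g 0 * h (suc k)) + (f 0 * (tl g ⊛ h) k + (tl f ⊛ (g ⊛ h)) k)
        ≈⟨ +-assoc _ _ _ ⟨
      (f 0 * (g 0 * h (suc k)) + f 0 * (tl g ⊛ h) k) + (tl f ⊛ (g ⊛ h)) k
        ≈⟨ +-congʳ (distribˡ _ _ _) ⟨
      f 0 * (g 0 * h (suc k) + (tl g ⊛ h) k) + (tl f ⊛ (g ⊛ h)) k  ∎

    unfoldʳ : ∀ k f g → (f ⊛ g) (suc k) ≈ (f ⊛ tl g) k + f (suc k) * g 0
    unfoldʳ zero f g = begin
      f 0 * g 1 + (f 1 * g 0 + 0#)   ≈⟨ +-congˡ (+-identityʳ _) ⟩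
      f 0 * g 1 + f 1 * g 0          ≈⟨ +-congʳ (+-identityʳ _) ⟨
      (f 0 * g 1 + 0#) + f 1 * g 0   ∎
    unfoldʳ (suc k) f g = begin
      f 0 * g (suc (suc k)) + (tl f ⊛ g) (suc k)
        ≈⟨ +-congˡ (unfoldʳ k (tl f) g) ⟩
      f 0 * g (suc (suc k)) + ((tl f ⊛ tl g) k + f (suc (suc k)) * g 0)
        ≈⟨ +-assoc _ _ _ ⟨
      (f 0 * g (suc (suc k)) + (tl f ⊛ tl g) k) + f (suc (suc k)) * g 0  ∎

    comm-at : ∀ k f g → (f ⊛ g) k ≈ (g ⊛ f) k
    comm-at zero f g = +-congʳ (*-comm _ _)
    comm-at (suc k) f g = begin
      f 0 * g (suc k) + (tl f ⊛ g) k   ≈⟨ +-cong (*-comm _ _) (comm-at k (tl f) g) ⟩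
      g (suc k) * f 0 + (g ⊛ tl f) k   ≈⟨ +-comm _ _ ⟩
      (g ⊛ tl f) k + g (suc k) * f 0   ≈⟨ unfoldʳ k g f ⟨
      (g ⊛ f) (suc k)                  ∎

    identityˡ-at : ∀ k f → (C 1# ⊛ f) k ≈ f k
    identityˡ-at zero    f = trans (+-identityʳ _) (*-identityˡ _)
    identityˡ-at (suc k) f = begin
      1# * f (suc k) + (tl (C 1#) ⊛ f) k  ≈⟨ +-cong (*-identityˡ _) (zeroˡ-at k f) ⟩
      f (suc k) + 0#                      ≈⟨ +-identityʳ _ ⟩
      f (suc k)                           ∎

  powerSeriesRing : CommutativeRing c ℓ
  powerSeriesRing = record
    { Carrier = PowerSeries
    ; _≈_     = _≋_
    ; _+_     = _⊕_
    ; _*_     = _⊛_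
    ; -_      = ⊖_
    ; 0#      = λ _ → 0#
    ; 1#      = C 1#
    ; isCommutativeRing = record
      { isRing = record
        { +-isAbelianGroup = P.isAbelianGroup +-isAbelianGroup
        ; *-cong     = λ f≋ g≋ k → cong-at k f≋ g≋
        ; *-assoc    = λ f g h k → assoc-at k f g h
        ; *-identity = (λ f k → identityˡ-at k f)
                     , (λ f k → trans (comm-at k f (C 1#)) (identityˡ-at k f))
        ; distrib    = (λ f g h k → begin
                          (f ⊛ (g ⊕ h)) k          ≈⟨ comm-at k f (g ⊕ h) ⟩
                          ((g ⊕ h) ⊛ f) k          ≈⟨ distribʳ-at k f g h ⟩
                          (g ⊛ f) k + (h ⊛ f) k    ≈⟨ +-cong (comm-at k g f) (comm-at k h f) ⟩
                          (f ⊛ g) k + (f ⊛ h) k    ∎)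
                     , (λ h f g k → distribʳ-at k h f g)
        }
      ; *-comm = λ f g k → comm-at k f g
      }
    }

module Determinant {c ℓ} (R : CommutativeRing c ℓ) where

  open CommutativeRing R hiding (zero)
  open RawMonoidDefinitions +-rawMonoid using (sum)
  open Exponentiation semiring using (_^_)

  SquareMatrix : ℕ → Set c
  SquareMatrix n = Vector (Vector Carrier n) n

  identity : ∀ n → SquareMatrix n
  identity n i j = if does (i Fin.≟ j) then 1# else 0#

  -- Laplace expansion along the first row.
  det : ∀ {n} → SquareMatrix n → Carrier
  det {zero}  A = 1#
  det {suc n} A = sum λ j →
    (- 1#) ^ toℕ j * A zero j * det (λ i k → A (suc i) (punchIn j k))

data Choice : Set where
  add2 remove1 : Choice

move : Choice → ℕ → ℕ
move add2    c = c +ℕ 2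
move remove1 c = c ∸ 1

-- Starting with s chips and making the given k moves, the pile has n or more
-- chips after all k of them, and at no earlier time.
endsExactlyAfter : ∀ {k} → ℕ → ℕ → Vec Choice k → Bool
endsExactlyAfter n s []      = n ≤ᵇ s
endsExactlyAfter n s (a ∷ w) = (s <ᵇ n) ∧ endsExactlyAfter n (move a s) w

-- Only the relation p + q = 1 matters, so probabilities are taken in an
-- arbitrary commutative ring; the real case is R = ℝ with 0 ≤ p ≤ 1.
module PileGame {c ℓ} (R : CommutativeRing c ℓ) (p : CommutativeRing.Carrier R) where

  private module R = CommutativeRing R

  q : R.Carrier
  q = R.1# R.- p

  weight : Choice → R.Carrier
  weight add2    = p
  weight remove1 = q

  -- Probability of an event depending on k independent choices.
  prob : ∀ k → (Vec Choice k → Bool) → R.Carrier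
  prob zero    E = if E [] then R.1# else R.0#
  prob (suc k) E = weight add2    R.* prob k (λ w → E (add2 ∷ w))
                 R.+ weight remove1 R.* prob k (λ w → E (remove1 ∷ w))

  B : ℕ → ℕ → ℕ → R.Carrier
  B n k s = prob k (endsExactlyAfter n s)

  transition : ∀ n → Fin n → Fin n → R.Carrier
  transition n s t = prob 1 (λ w → move (head w) (toℕ s) ≡ᵇ toℕ t)

  open FormalPowerSeries R public
    using (PowerSeries; C; X; IsPolynomial; powerSeriesRing)
  open CommutativeRing powerSeriesRing public
    using (_≈_; _+_; _*_; _-_; semiring)
  open Exponentiation semiring public using (_^_)
  open Determinant powerSeriesRing using (SquareMatrix; identity; det)

  G : ℕ → ℕ → PowerSeries
  G n s k = B n k s

  coefficientMatrix : ∀ n → SquareMatrix n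
  coefficientMatrix n s t = identity n s t - X * C (transition n s t)

  D : ℕ → PowerSeries
  D n = det (coefficientMatrix n)

-- Write a = px, b = qx, and let E_m be the determinant of the Toeplitz band
-- matrix with 1 on the diagonal, -b below it and -a two places above it.  Twice
-- clearing a first column gives E_{m+3} = E_{m+2} - ab²E_m, and the matrix of D
-- differs from that of E only by -b in its corner, so D_{m+1} = E_{m+1} - bE_m
-- inherits the recurrence.
-- Eliminating states from 0 upwards gives
--   D_{s+1} G_s = ab D_{s-1} G_{s+1} + a D_s G_{s+2},
-- and, moving the exit point up to n, D_n G_s becomes a polynomial: a jump over
-- m lands on m or m + 1, with coefficients satisfying a three-term recurrence.
module Submission where

open import Defs
open import Algebra.Bundles using (CommutativeRing)
import Algebra.Properties.Group as GroupProperties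
import Algebra.Properties.Monoid.Sum as Sum
import Algebra.Properties.Quasigroup as QuasigroupProperties
import Algebra.Properties.Ring as RingProperties
import Algebra.Properties.Semiring.Exp as Exponentiation
import Algebra.Solver.Ring.NaturalCoefficients.Default as SemiringSolver
open import Data.Bool.Base using (false)
open import Data.Fin.Base using (Fin; zero; suc; toℕ; punchIn)
open import Data.Nat.Base using (ℕ; zero; suc; _∸_; _≤_; _<_; z≤n; s≤s)
  renaming (_+_ to _+ℕ_)
import Data.Nat.Properties as ℕ
open import Data.Product.Base using (∃; _×_; _,_)
open import Data.Sum.Base using (inj₁; inj₂)
open import Relation.Binary.PropositionalEquality.Core as ≡ using (_≡_)
import Relation.Binary.Reasoning.Setoid as SetoidReasoning
open import Relation.Nullary.Decidable using (dec-true; dec-false)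

-- Determinants under Laplace expansion along the first row.

module DeterminantProperties {c ℓ} (R : CommutativeRing c ℓ) where

  open CommutativeRing R hiding (zero)
  open Determinant R
  open Exponentiation semiring using (_^_)
  open GroupProperties +-group using (⁻¹-involutive)
  open RingProperties ring using (-‿distribˡ-*; -‿distribʳ-*; -1*x≈-x)
  open Sum +-monoid using (sum; sum-cong-≋; sum-replicate-zero)
  open SemiringSolver commutativeSemiring using (solve; con; _:+_; _:*_; _:=_)
  open SetoidReasoning setoid

  minor : ∀ {n} → SquareMatrix (suc n) → Fin (suc n) → SquareMatrix n
  minor A j i k = A (suc i) (punchIn j k)

  private
    zeroEntry : ∀ {x z} y → x ≈ 0# → y * x * z ≈ 0#
    zeroEntry y x≈0 = trans (*-congʳ (trans (*-congˡ x≈0) (zeroʳ y))) (zeroˡ _)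

    sum-zero : ∀ n {f : Fin n → Carrier} → (∀ i → f i ≈ 0#) → sum f ≈ 0#
    sum-zero n f≈0 = trans (sum-cong-≋ f≈0) (sum-replicate-zero n)

    laplaceTerm : ∀ {n} → SquareMatrix (suc n) → Fin (suc n) → Carrier
    laplaceTerm A j = (- 1#) ^ toℕ j * A zero j * det (minor A j)

  -- In the first-row expansion the term of column `zero` has a zero entry, and every other minor
  -- still contains the zero column, so induction on the size applies.
  det-zeroColumn : ∀ n (A : SquareMatrix (suc n)) → (∀ i → A i zero ≈ 0#) → det A ≈ 0#
  det-zeroColumn n A z = sum-zero (suc n) (terms≈0 n A z)
    where
    terms≈0 : ∀ n (A : SquareMatrix (suc n)) → (∀ i → A i zero ≈ 0#) →
              ∀ j → laplaceTerm A j ≈ 0#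
    terms≈0 n       A z zero    = zeroEntry _ (z zero)
    terms≈0 (suc n) A z (suc j) =
      trans (*-congˡ (sum-zero (suc n) (terms≈0 n (minor A (suc j)) (λ i → z (suc i)))))
            (zeroʳ _)

  det-headRow : ∀ n (A : SquareMatrix (suc n)) → (∀ j → A zero (suc j) ≈ 0#) →
                det A ≈ A zero zero * det (minor A zero)
  det-headRow n A z = begin
    laplaceTerm A zero + sum (λ j → laplaceTerm A (suc j))
      ≈⟨ +-cong (*-congʳ (*-identityˡ _))
                (sum-zero n {λ j → laplaceTerm A (suc j)} (λ j → zeroEntry _ (z j))) ⟩
    A zero zero * det (minor A zero) + 0#
      ≈⟨ +-identityʳ _ ⟩
    A zero zero * det (minor A zero) ∎

  det-cong : ∀ n {A B : SquareMatrix n} → (∀ i j → A i j ≈ B i j) → det A ≈ det B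
  det-cong zero    A≈B = refl
  det-cong (suc n) {A} {B} A≈B = sum-cong-≋ {suc n} {laplaceTerm A} {laplaceTerm B} λ j →
    *-cong (*-congˡ (A≈B zero j)) (det-cong n (λ i k → A≈B (suc i) (punchIn j k)))

  -- The determinant is affine in its corner entry, with slope the corner minor. Writing the change
  -- as an addition keeps the identity within reach of a semiring solver.
  det-corner : ∀ n (A B : SquareMatrix (suc n)) {b} → A zero zero + b ≈ B zero zero →
    (∀ j → A zero (suc j) ≈ B zero (suc j)) → (∀ i j → A (suc i) j ≈ B (suc i) j) →
    det A + b * det (minor A zero) ≈ det B
  det-corner n A B {b} corner row rows = begin
    (1# * A zero zero * M + S) + b * M
      ≈⟨ solve 4 (λ x m s b → (con 1 :* x :* m :+ s) :+ b :* m := con 1 :* (x :+ b) :* m :+ s)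
           refl (A zero zero) M S b ⟩
    1# * (A zero zero + b) * M + S
      ≈⟨ +-cong (*-cong (*-congˡ corner) (minors zero))
                (sum-cong-≋ {n} {λ j → laplaceTerm A (suc j)} {λ j → laplaceTerm B (suc j)}
                  λ j → *-cong (*-congˡ (row j)) (minors (suc j))) ⟩
    det B ∎
    where
    M = det (minor A zero)
    S = sum (λ j → laplaceTerm A (suc j))

    minors : ∀ j → det (minor A j) ≈ det (minor B j)
    minors j = det-cong n (λ i k → rows i (punchIn j k))

  -- Column counterpart of `det-headRow`: every minor other than the corner one retains the first
  -- column, which is zero below the corner, and so vanishes by `det-zeroColumn`.
  det-headColumn : ∀ n (A : SquareMatrix (suc n)) → (∀ i → A (suc i) zero ≈ 0#) →
                   det A ≈ A zero zero * det (minor A zero)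
  det-headColumn n A z = begin
    1# * A zero zero * det (minor A zero) + sum (λ j → laplaceTerm A (suc j))
      ≈⟨ +-cong (*-congʳ (*-identityˡ _)) (sum-zero n (rest≈0 n A z)) ⟩
    A zero zero * det (minor A zero) + 0#
      ≈⟨ +-identityʳ _ ⟩
    A zero zero * det (minor A zero) ∎
    where
    rest≈0 : ∀ n (A : SquareMatrix (suc n)) → (∀ i → A (suc i) zero ≈ 0#) →
             ∀ j → laplaceTerm A (suc j) ≈ 0#
    rest≈0 (suc n) A z j = trans (*-congˡ (det-zeroColumn n (minor A (suc j)) z)) (zeroʳ _)

  private
    signSquared : ∀ x → (- 1#) ^ 2 * x ≈ x
    signSquared x = begin
      - 1# * (- 1# * 1#) * x
        ≈⟨ *-congʳ (trans (-1*x≈-x _) (trans (-‿cong (-1*x≈-x _)) (⁻¹-involutive 1#))) ⟩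
      1# * x
        ≈⟨ *-identityˡ x ⟩
      x ∎

    cubeNegated : ∀ a b x → - a * (- b * (- b * x)) ≈ - (a * (b * b) * x)
    cubeNegated a b x = begin
      - a * (- b * (- b * x))    ≈⟨ *-congˡ (*-congˡ (-‿distribˡ-* b x)) ⟨
      - a * (- b * - (b * x))    ≈⟨ *-congˡ (-‿distribˡ-* b _) ⟨
      - a * - (b * - (b * x))    ≈⟨ *-congˡ (-‿cong (-‿distribʳ-* b _)) ⟨
      - a * - (- (b * (b * x)))  ≈⟨ *-congˡ (⁻¹-involutive _) ⟩
      - a * (b * (b * x))        ≈⟨ -‿distribˡ-* a _ ⟨
      - (a * (b * (b * x)))      ≈⟨ -‿cong (trans (*-congˡ (sym (*-assoc b b x))) (sym (*-assoc a (b * b) x))) ⟩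
      - (a * (b * b) * x)        ∎

  -- The first row has nonzero entries only in columns 0 and 2. The minor at column 2 keeps columns
  -- 0 and 1, each of which in turn has a single entry `- b` at its head; the second term is
  -- therefore `- a` times `- b` twice times the remaining determinant.
  det-banded : ∀ n (A : SquareMatrix (suc (suc (suc n)))) {a b} →
    A zero zero ≈ 1# → A zero (suc zero) ≈ 0# → A zero (suc (suc zero)) ≈ - a →
    (∀ j → A zero (suc (suc (suc j))) ≈ 0#) →
    A (suc zero) zero ≈ - b → (∀ i → A (suc (suc i)) zero ≈ 0#) →
    A (suc (suc zero)) (suc zero) ≈ - b → (∀ i → A (suc (suc (suc i))) (suc zero) ≈ 0#) →
    det A + a * (b * b) * det (λ i j → A (suc (suc (suc i))) (suc (suc (suc j))))
      ≈ det (λ i j → A (suc i) (suc j))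
  det-banded n A {a} {b} a₀₀ a₀₁ a₀₂ a₀ⱼ a₁₀ aᵢ₀ a₂₁ aᵢ₁ = begin
    det A + y
      ≈⟨ +-congʳ expansion ⟩
    (x + (- y + (0# + 0#))) + y
      ≈⟨ +-congʳ (+-congˡ (trans (+-congˡ (+-identityʳ 0#)) (+-identityʳ (- y)))) ⟩
    (x + - y) + y
      ≈⟨ +-assoc _ _ _ ⟩
    x + (- y + y)
      ≈⟨ +-congˡ (-‿inverseˡ y) ⟩
    x + 0#
      ≈⟨ +-identityʳ x ⟩
    x ∎
    where
    A₃ = λ i j → A (suc (suc (suc i))) (suc (suc (suc j)))
    x = det (λ i j → A (suc i) (suc j))
    y = a * (b * b) * det A₃

    minor₂ : det (minor A (suc (suc zero))) ≈ - b * (- b * det A₃)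
    minor₂ = begin
      det (minor A (suc (suc zero)))
        ≈⟨ det-headColumn (suc n) (minor A (suc (suc zero))) aᵢ₀ ⟩
      A (suc zero) zero * det (minor (minor A (suc (suc zero))) zero)
        ≈⟨ *-cong a₁₀ (det-headColumn n (minor (minor A (suc (suc zero))) zero) aᵢ₁) ⟩
      - b * (A (suc (suc zero)) (suc zero) * det A₃)
        ≈⟨ *-congˡ (*-congʳ a₂₁) ⟩
      - b * (- b * det A₃) ∎

    expansion : det A ≈ x + (- y + (0# + 0#))
    expansion = begin
      det A
        ≈⟨ +-cong (*-congʳ (trans (*-identityˡ _) a₀₀))
             (+-cong (zeroEntry _ a₀₁)
               (+-cong (*-cong (trans (signSquared _) a₀₂) minor₂)
                 (sum-zero n {λ j → laplaceTerm A (suc (suc (suc j)))} (λ j → zeroEntry _ (a₀ⱼ j))))) ⟩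
      1# * x + (0# + (- a * (- b * (- b * det A₃)) + 0#))
        ≈⟨ +-cong (*-identityˡ x) (+-identityˡ _) ⟩
      x + (- a * (- b * (- b * det A₃)) + 0#)
        ≈⟨ +-congˡ (+-cong (cubeNegated a b _) (sym (+-identityʳ 0#))) ⟩
      x + (- y + (0# + 0#)) ∎

-- From the Toeplitz determinants to the recurrence for `D`.

module LinearSystem {c ℓ} (R : CommutativeRing c ℓ) where

  open CommutativeRing R hiding (zero)
  open GroupProperties +-group using () renaming (∙-cancelʳ to +-cancelʳ)
  open SemiringSolver commutativeSemiring using (solve; _:+_; _:*_; _:=_)
  open SetoidReasoning setoid

  module Corner (a b : Carrier) (D E : ℕ → Carrier)
    (D₀ : D 0 ≈ 1#) (E₀ : E 0 ≈ 1#) (E₁ : E 1 ≈ 1#) (E₂ : E 2 ≈ 1#)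
    (corner : ∀ m → D (suc m) + b * E m ≈ E (suc m))
    (banded : ∀ m → E (3 +ℕ m) + a * (b * b) * E m ≈ E (2 +ℕ m))
    where

    -- D shifted by one: D₋₁ = 0 extends the recurrence down to D₂ = D₁.
    d : ℕ → Carrier
    d zero    = 0#
    d (suc m) = D m

    d₂ : d 2 + b ≈ 1#
    d₂ = begin
      D 1 + b        ≈⟨ +-congˡ (trans (*-congˡ E₀) (*-identityʳ b)) ⟨
      D 1 + b * E 0  ≈⟨ trans (corner 0) E₁ ⟩
      1#             ∎

    recurrence : ∀ m → d (3 +ℕ m) + a * (b * b) * d m ≈ d (2 +ℕ m)
    -- This case says D₂ = D₁, which holds because E₀ = E₁ = E₂.
    recurrence zero = trans (trans (+-congˡ (zeroʳ _)) (+-identityʳ _)) (+-cancelʳ (b * E 1) _ _ (begin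
      D 2 + b * E 1  ≈⟨ corner 1 ⟩
      E 2            ≈⟨ trans E₂ (sym E₁) ⟩
      E 1            ≈⟨ corner 0 ⟨
      D 1 + b * E 0  ≈⟨ +-congˡ (*-congˡ (trans E₀ (sym E₁))) ⟩
      D 1 + b * E 1  ∎))
    -- `corner` has no instance for D₀; D₀ = E₀ takes its place, as if E₋₁ were 0.
    recurrence (suc zero) = +-cancelʳ (b * E 2) _ _ (begin
      (D 3 + a * (b * b) * D 0) + b * E 2
        ≈⟨ solve 3 (λ x y z → (x :+ y) :+ z := (x :+ z) :+ y) refl _ _ _ ⟩
      (D 3 + b * E 2) + a * (b * b) * D 0
        ≈⟨ +-cong (corner 2) (*-congˡ (trans D₀ (sym E₀))) ⟩
      E 3 + a * (b * b) * E 0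
        ≈⟨ banded 0 ⟩
      E 2
        ≈⟨ corner 1 ⟨
      D 2 + b * E 1
        ≈⟨ +-congˡ (*-congˡ (trans E₁ (sym E₂))) ⟩
      D 2 + b * E 2 ∎)
    -- The recurrence for `E` at `suc m` minus `b` times the one at `m`. The subtracted quantities
    -- are added to both sides and cancelled.
    recurrence (suc (suc m)) = +-cancelʳ (b * E (3 +ℕ m) + a * (b * b) * (b * E m)) _ _ (begin
      (D (4 +ℕ m) + a * (b * b) * D (suc m)) + (b * E (3 +ℕ m) + a * (b * b) * (b * E m))
        ≈⟨ solve 6 (λ w x y z a b →
               (w :+ a :* (b :* b) :* x) :+ (b :* y :+ a :* (b :* b) :* (b :* z))
            := (w :+ b :* y) :+ a :* (b :* b) :* (x :+ b :* z)) refl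
             (D (4 +ℕ m)) (D (suc m)) (E (3 +ℕ m)) (E m) a b ⟩
      (D (4 +ℕ m) + b * E (3 +ℕ m)) + a * (b * b) * (D (suc m) + b * E m)
        ≈⟨ +-cong (corner (3 +ℕ m)) (*-congˡ (corner m)) ⟩
      E (4 +ℕ m) + a * (b * b) * E (suc m)
        ≈⟨ banded (suc m) ⟩
      E (3 +ℕ m)
        ≈⟨ corner (2 +ℕ m) ⟨
      D (3 +ℕ m) + b * E (2 +ℕ m)
        ≈⟨ +-congˡ (*-congˡ (banded m)) ⟨
      D (3 +ℕ m) + b * (E (3 +ℕ m) + a * (b * b) * E m)
        ≈⟨ solve 5 (λ w y z a b → w :+ b :* (y :+ a :* (b :* b) :* z)
                    := w :+ (b :* y :+ a :* (b :* b) :* (b :* z))) refl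
             (D (3 +ℕ m)) (E (3 +ℕ m)) (E m) a b ⟩
      D (3 +ℕ m) + (b * E (3 +ℕ m) + a * (b * b) * (b * E m)) ∎)

  -- Solving the linear system without division.

  module Elimination (a b : Carrier)
    (d : ℕ → Carrier) (d₀ : d 0 ≈ 0#) (d₁ : d 1 ≈ 1#) (d₂ : d 2 + b ≈ 1#)
    (recurrence : ∀ m → d (3 +ℕ m) + a * (b * b) * d m ≈ d (2 +ℕ m))
    (cancelˡ : ∀ m x y → d (suc m) * x ≈ d (suc m) * y → x ≈ y)
    (n : ℕ) (G : ℕ → Carrier)
    (system : ∀ s → s < n → G s ≈ a * G (2 +ℕ s) + b * G (s ∸ 1))
    where

    -- Multiplying equation `suc s` by `d (2 +ℕ s)` lets the induction hypothesis replace `G s`.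
    -- This produces a multiple of `G (suc s)` which, moved to the left, turns `d (2 +ℕ s)` into
    -- `d (3 +ℕ s)` by the recurrence. At `s = 0` the boundary term `b * G 0` turns 1 into `d 2`.
    eliminate : ∀ s → s < n →
      d (2 +ℕ s) * G s ≈ a * b * d s * G (1 +ℕ s) + a * d (1 +ℕ s) * G (2 +ℕ s)
    eliminate zero 0<n = +-cancelʳ (b * G 0) _ _ (begin
      d 2 * G 0 + b * G 0
        ≈⟨ distribʳ _ _ _ ⟨
      (d 2 + b) * G 0
        ≈⟨ trans (*-congʳ d₂) (*-identityˡ _) ⟩
      G 0
        ≈⟨ system 0 0<n ⟩
      a * G 2 + b * G 0
        ≈⟨ +-congʳ (trans (+-cong (trans (*-congʳ (trans (*-congˡ d₀) (zeroʳ _))) (zeroˡ _))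
                                  (*-congʳ (trans (*-congˡ d₁) (*-identityʳ a))))
                          (+-identityˡ _)) ⟨
      (a * b * d 0 * G 1 + a * d 1 * G 2) + b * G 0 ∎)
    eliminate (suc s) s<n = +-cancelʳ (a * (b * b) * d s * G (suc s)) _ _ (begin
      d (3 +ℕ s) * G (suc s) + a * (b * b) * d s * G (suc s)
        ≈⟨ distribʳ _ _ _ ⟨
      (d (3 +ℕ s) + a * (b * b) * d s) * G (suc s)
        ≈⟨ *-cong (recurrence s) (system (suc s) s<n) ⟩
      d (2 +ℕ s) * (a * G (3 +ℕ s) + b * G s)
        ≈⟨ solve 5 (λ a b d g h → d :* (a :* g :+ b :* h) := a :* d :* g :+ b :* (d :* h)) refl
             a b (d (2 +ℕ s)) (G (3 +ℕ s)) (G s) ⟩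
      a * d (2 +ℕ s) * G (3 +ℕ s) + b * (d (2 +ℕ s) * G s)
        ≈⟨ +-congˡ (*-congˡ (eliminate s (ℕ.<-trans (ℕ.n<1+n s) s<n))) ⟩
      a * d (2 +ℕ s) * G (3 +ℕ s) + b * (a * b * d s * G (1 +ℕ s) + a * d (1 +ℕ s) * G (2 +ℕ s))
        ≈⟨ solve 8 (λ a b d₀ d₁ d₂ g₁ g₂ g₃ →
               a :* d₂ :* g₃ :+ b :* (a :* b :* d₀ :* g₁ :+ a :* d₁ :* g₂)
            := (a :* b :* d₁ :* g₂ :+ a :* d₂ :* g₃) :+ a :* (b :* b) :* d₀ :* g₁) refl
             a b (d s) (d (1 +ℕ s)) (d (2 +ℕ s)) (G (1 +ℕ s)) (G (2 +ℕ s)) (G (3 +ℕ s)) ⟩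
      (a * b * d (suc s) * G (2 +ℕ s) + a * d (2 +ℕ s) * G (3 +ℕ s)) + a * (b * b) * d s * G (suc s) ∎)

    -- f s (suc j) / d (suc (j + s)) is the generating function of the first exit
    -- from {0, …, j + s - 1}, started at s, landing on j + s.  The characteristic
    -- roots of f are the products of two roots of t³ = t² - ab², divided by b.
    f : ℕ → ℕ → Carrier
    f s 0 = 0#
    f s 1 = d (suc s)
    f s 2 = a * b * d s
    f s (suc (suc (suc j))) = a * f s (suc j) + a * a * b * f s j

    -- The right side is the coefficient that arises in `exit` when the exit point moves up by one.
    -- Its divisibility by `d (suc (j +ℕ s))` permits the cancellation there.
    f-d : ∀ s j → f s (2 +ℕ j) * d (suc (j +ℕ s))
                ≈ a * b * f s (suc j) * d (j +ℕ s) + a * f s j * d (2 +ℕ (j +ℕ s))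
    f-d s zero = begin
      a * b * d s * d (suc s)
        ≈⟨ solve 4 (λ a b x y → a :* b :* x :* y := a :* b :* y :* x) refl a b (d s) (d (suc s)) ⟩
      a * b * d (suc s) * d s
        ≈⟨ +-identityʳ _ ⟨
      a * b * d (suc s) * d s + 0#
        ≈⟨ +-congˡ (trans (*-congʳ (zeroʳ a)) (zeroˡ _)) ⟨
      a * b * d (suc s) * d s + a * 0# * d (2 +ℕ s) ∎
    f-d s (suc j) = begin
      (a * f₁ + a * a * b * f₀) * D₂
        ≈⟨ solve 5 (λ a b f₀ f₁ D₂ → (a :* f₁ :+ a :* a :* b :* f₀) :* D₂
                    := a :* f₁ :* D₂ :+ a :* a :* b :* f₀ :* D₂) refl a b f₀ f₁ D₂ ⟩
      a * f₁ * D₂ + a * a * b * f₀ * D₂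
        -- Only the `D₂` next to `f₁` is expanded: its `D₀` part joins the `f₀` term to form `a * b`
        -- times the right side of the previous case.
        ≈⟨ +-congʳ (*-congˡ (recurrence (j +ℕ s))) ⟨
      a * f₁ * (D₃ + a * (b * b) * D₀) + a * a * b * f₀ * D₂
        ≈⟨ solve 7 (λ a b f₀ f₁ D₀ D₂ D₃ →
               a :* f₁ :* (D₃ :+ a :* (b :* b) :* D₀) :+ a :* a :* b :* f₀ :* D₂
            := a :* b :* (a :* b :* f₁ :* D₀ :+ a :* f₀ :* D₂) :+ a :* f₁ :* D₃) refl
             a b f₀ f₁ D₀ D₂ D₃ ⟩
      a * b * (a * b * f₁ * D₀ + a * f₀ * D₂) + a * f₁ * D₃
        ≈⟨ +-congʳ (*-congˡ (f-d s j)) ⟨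
      a * b * (f s (2 +ℕ j) * d (suc (j +ℕ s))) + a * f₁ * D₃
        ≈⟨ +-congʳ (*-assoc _ _ _) ⟨
      a * b * f s (2 +ℕ j) * d (suc (j +ℕ s)) + a * f₁ * D₃ ∎
      where
      f₀ = f s j
      f₁ = f s (suc j)
      D₀ = d (j +ℕ s)
      D₂ = d (2 +ℕ (j +ℕ s))
      D₃ = d (3 +ℕ (j +ℕ s))

    -- To move the exit point from `m` to `m + 1`, multiply by `d (2 +ℕ m)` and substitute
    -- `eliminate m` for `G m`. By `f-d` both sides then have the factor `d (suc m)`; cancelling it
    -- leaves a single determinant as denominator.
    exit : ∀ s j → j +ℕ s ≤ n →
      d (suc (j +ℕ s)) * G s ≈ f s (suc j) * G (j +ℕ s) + a * f s j * G (suc (j +ℕ s))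
    exit s zero _ = sym (trans (+-congˡ (trans (*-congʳ (zeroʳ a)) (zeroˡ _))) (+-identityʳ _))
    exit s (suc j) m<n = cancelˡ m _ _ (begin
      D₁ * (D₂ * G s)
        ≈⟨ solve 3 (λ x y z → x :* (y :* z) := y :* (x :* z)) refl D₁ D₂ (G s) ⟩
      D₂ * (D₁ * G s)
        ≈⟨ *-congˡ (exit s j (ℕ.<⇒≤ m<n)) ⟩
      D₂ * (f₁ * G m + a * f₀ * G (suc m))
        ≈⟨ solve 6 (λ a D₂ f₀ f₁ g₀ g₁ → D₂ :* (f₁ :* g₀ :+ a :* f₀ :* g₁)
                    := f₁ :* (D₂ :* g₀) :+ a :* f₀ :* D₂ :* g₁) refl
             a D₂ f₀ f₁ (G m) (G (suc m)) ⟩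
      f₁ * (D₂ * G m) + a * f₀ * D₂ * G (suc m)
        ≈⟨ +-congʳ (*-congˡ (eliminate m m<n)) ⟩
      f₁ * (a * b * d m * G (suc m) + a * D₁ * G (2 +ℕ m)) + a * f₀ * D₂ * G (suc m)
        ≈⟨ solve 9 (λ a b D₀ D₁ D₂ f₀ f₁ g₁ g₂ →
               f₁ :* (a :* b :* D₀ :* g₁ :+ a :* D₁ :* g₂) :+ a :* f₀ :* D₂ :* g₁
            := (a :* b :* f₁ :* D₀ :+ a :* f₀ :* D₂) :* g₁ :+ D₁ :* (a :* f₁ :* g₂)) refl
             a b (d m) D₁ D₂ f₀ f₁ (G (suc m)) (G (2 +ℕ m)) ⟩
      (a * b * f₁ * d m + a * f₀ * D₂) * G (suc m) + D₁ * (a * f₁ * G (2 +ℕ m))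
        ≈⟨ +-congʳ (*-congʳ (f-d s j)) ⟨
      f s (2 +ℕ j) * D₁ * G (suc m) + D₁ * (a * f₁ * G (2 +ℕ m))
        ≈⟨ solve 4 (λ f D₁ g y → f :* D₁ :* g :+ D₁ :* y := D₁ :* (f :* g :+ y)) refl
             (f s (2 +ℕ j)) D₁ (G (suc m)) (a * f₁ * G (2 +ℕ m)) ⟩
      D₁ * (f s (2 +ℕ j) * G (suc m) + a * f₁ * G (2 +ℕ m)) ∎)
      where
      m = j +ℕ s
      f₀ = f s j
      f₁ = f s (suc j)
      D₁ = d (suc m)
      D₂ = d (2 +ℕ m)

-- Power series: shifts, cancellation and polynomials.

module PowerSeriesProperties {c ℓ} (R : CommutativeRing c ℓ) where

  open CommutativeRing R hiding (zero)
  open FormalPowerSeries R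
  private module S = CommutativeRing powerSeriesRing
  open GroupProperties +-group using (ε⁻¹≈ε) renaming (∙-cancelʳ to +-cancelʳ)
  open SetoidReasoning setoid

  C-cong : ∀ {u v} → u ≈ v → C u ≋ C v
  C-cong u≈v zero    = u≈v
  C-cong u≈v (suc _) = refl

  C0≋0 : ∀ {u} → u ≈ 0# → C u ≋ S.0#
  C0≋0 u≈0 zero    = u≈0
  C0≋0 u≈0 (suc _) = refl

  C-⊛ : ∀ u f k → (C u ⊛ f) k ≈ u * f k
  C-⊛ u f zero    = +-identityʳ _
  C-⊛ u f (suc k) = trans (+-congˡ (S.zeroˡ f k)) (+-identityʳ _)

  X-⊛-zero : ∀ f → (X ⊛ f) 0 ≈ 0#
  X-⊛-zero f = trans (+-identityʳ _) (zeroˡ _)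

  X-⊛-suc : ∀ f k → (X ⊛ f) (suc k) ≈ f k
  X-⊛-suc f k = begin
    0# * f (suc k) + ((λ i → X (suc i)) ⊛ f) k
      ≈⟨ +-cong (zeroˡ _) (S.*-cong {λ i → X (suc i)} {C 1#} {f} {f}
                             (λ { zero → refl ; (suc _) → refl }) S.refl k) ⟩
    0# + (C 1# ⊛ f) k
      ≈⟨ trans (+-identityˡ _) (S.*-identityˡ f k) ⟩
    f k ∎

  XC-⊛-zero : ∀ u f → (X ⊛ C u ⊛ f) 0 ≈ 0#
  XC-⊛-zero u f = trans (S.*-assoc X (C u) f 0) (X-⊛-zero (C u ⊛ f))

  XC-⊛-suc : ∀ u f k → (X ⊛ C u ⊛ f) (suc k) ≈ u * f k
  XC-⊛-suc u f k = trans (S.*-assoc X (C u) f (suc k)) (trans (X-⊛-suc (C u ⊛ f) k) (C-⊛ u f k))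

  ⊛-cong-below : ∀ k f {g h} → (∀ j → j ≤ k → g j ≈ h j) → (f ⊛ g) k ≈ (f ⊛ h) k
  ⊛-cong-below zero    f g≈h = +-congʳ (*-congˡ (g≈h 0 ℕ.≤-refl))
  ⊛-cong-below (suc k) f g≈h =
    +-cong (*-congˡ (g≈h (suc k) ℕ.≤-refl))
           (⊛-cong-below k (λ i → f (suc i)) (λ j j≤k → g≈h j (ℕ.m≤n⇒m≤1+n j≤k)))

  -- The base ring may have zero divisors, so cancellation rests on the constant term 1. Once the
  -- lower coefficients of `g` and `h` agree, coefficient `k` of the products differs only in the
  -- term `f 0` times the new coefficient.
  ⊛-cancelˡ : ∀ f g h → f 0 ≈ 1# → f ⊛ g ≋ f ⊛ h → g ≋ h
  ⊛-cancelˡ f g h f₀ fg≋fh k = below k k ℕ.≤-refl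
    where
    unit : ∀ {x y} → f 0 * x ≈ f 0 * y → x ≈ y
    unit {x} {y} eq = begin
      x        ≈⟨ trans (*-congʳ f₀) (*-identityˡ x) ⟨
      f 0 * x  ≈⟨ eq ⟩
      f 0 * y  ≈⟨ trans (*-congʳ f₀) (*-identityˡ y) ⟩
      y        ∎

    below : ∀ k j → j ≤ k → g j ≈ h j
    below zero zero _ = unit (+-cancelʳ 0# _ _ (fg≋fh 0))
    below (suc k) j j≤1+k with ℕ.m≤n⇒m<n∨m≡n j≤1+k
    ... | inj₁ (s≤s j≤k) = below k j j≤k
    ... | inj₂ ≡.refl = unit (+-cancelʳ (((λ i → f (suc i)) ⊛ h) k) _ _ (begin
      f 0 * g (suc k) + ((λ i → f (suc i)) ⊛ h) k
        ≈⟨ +-congˡ (⊛-cong-below k (λ i → f (suc i)) (below k)) ⟨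
      f 0 * g (suc k) + ((λ i → f (suc i)) ⊛ g) k
        ≈⟨ fg≋fh (suc k) ⟩
      f 0 * h (suc k) + ((λ i → f (suc i)) ⊛ h) k ∎))

  IsPolynomial-resp : ∀ {f g} → f ≋ g → IsPolynomial f → IsPolynomial g
  IsPolynomial-resp f≋g (d , z) = d , λ k d≤k → trans (sym (f≋g k)) (z k d≤k)

  IsPolynomial-0 : IsPolynomial S.0#
  IsPolynomial-0 = 0 , λ _ _ → refl

  IsPolynomial-C : ∀ u → IsPolynomial (C u)
  IsPolynomial-C u = 1 , λ { (suc _) _ → refl }

  IsPolynomial-X : IsPolynomial X
  IsPolynomial-X = 2 , λ { (suc (suc _)) _ → refl ; (suc zero) (s≤s ()) }

  IsPolynomial-⊕ : ∀ {f g} → IsPolynomial f → IsPolynomial g → IsPolynomial (f ⊕ g)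
  IsPolynomial-⊕ (d , zf) (e , zg) = d +ℕ e , λ k d+e≤k →
    trans (+-cong (zf k (ℕ.m+n≤o⇒m≤o d d+e≤k)) (zg k (ℕ.m+n≤o⇒n≤o d d+e≤k))) (+-identityʳ 0#)

  IsPolynomial-⊖ : ∀ {f} → IsPolynomial f → IsPolynomial (⊖ f)
  IsPolynomial-⊖ (d , z) = d , λ k d≤k → trans (-‿cong (z k d≤k)) ε⁻¹≈ε

  -- In degree `d + e` or more, each term of the convolution has a vanishing factor. The induction
  -- on `d` removes the constant coefficient of `f`.
  IsPolynomial-⊛ : ∀ {f g} → IsPolynomial f → IsPolynomial g → IsPolynomial (f ⊛ g)
  IsPolynomial-⊛ {f} {g} (d , zf) (e , zg) = d +ℕ e , vanish d f zf
    where
    vanish : ∀ d f → (∀ k → d ≤ k → f k ≈ 0#) → ∀ k → d +ℕ e ≤ k → (f ⊛ g) k ≈ 0#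
    vanish zero f zf k _ =
      trans (S.*-cong {f} {S.0#} {g} {g} (λ i → zf i z≤n) S.refl k) (S.zeroˡ g k)
    vanish (suc d) f zf (suc k) (s≤s d+e≤k) = trans
      (+-cong (trans (*-congˡ (zg (suc k) (ℕ.m≤n⇒m≤1+n (ℕ.m+n≤o⇒n≤o d d+e≤k)))) (zeroʳ _))
              (vanish d (λ i → f (suc i)) (λ i d≤i → zf (suc i) (s≤s d≤i)) k d+e≤k))
      (+-identityʳ 0#)

module Monomial {c ℓ} (R : CommutativeRing c ℓ) where

  open CommutativeRing R
  open Exponentiation semiring using (_^_)
  open SemiringSolver commutativeSemiring using (solve; con; _:*_; _:=_)

  -- Rewrites ab² as the monomial pq²x³ of the theorem.
  cubic : ∀ u v x → (x * u) * ((x * v) * (x * v)) ≈ u * v ^ 2 * x ^ 3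
  cubic = solve 3 (λ u v x → (x :* u) :* ((x :* v) :* (x :* v))
    := u :* (v :* (v :* con 1)) :* (x :* (x :* (x :* con 1)))) refl

-- The determinants of the pile game.

module PileGameProperties {c ℓ} (R : CommutativeRing c ℓ) (p : CommutativeRing.Carrier R) where

  private module R = CommutativeRing R
  open PileGame R p
  open CommutativeRing powerSeriesRing
    hiding (_≈_; _+_; _*_; _-_; semiring; zero)
  open Determinant powerSeriesRing
  open DeterminantProperties powerSeriesRing
  open LinearSystem powerSeriesRing
  open Monomial powerSeriesRing
  open PowerSeriesProperties R

  open GroupProperties +-group using (quasigroup)
  open QuasigroupProperties quasigroup using (x≈z//y)

  a b : PowerSeries
  a = X * C p
  b = X * C q

  private
    -- A transition probability unfolds to `p` and `q` times indicators; this and the next two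
    -- evaluate the cases that occur.
    0-weights : (p R.* R.0#) R.+ (q R.* R.0#) R.≈ R.0#
    0-weights = R.trans (R.+-cong (R.zeroʳ p) (R.zeroʳ q)) (R.+-identityʳ R.0#)

    p-weight : (p R.* R.1#) R.+ (q R.* R.0#) R.≈ p
    p-weight = R.trans (R.+-cong (R.*-identityʳ p) (R.zeroʳ q)) (R.+-identityʳ p)

    q-weight : (p R.* R.0#) R.+ (q R.* R.1#) R.≈ q
    q-weight = R.trans (R.+-cong (R.zeroʳ p) (R.*-identityʳ q)) (R.+-identityˡ q)

    x-0≈x : ∀ x {u} → u R.≈ R.0# → x - X * C u ≈ x
    x-0≈x x {u} u≈0 = begin
      x + - (X * C u)  ≈⟨ +-congˡ {x} (-‿cong (trans (*-congˡ {X} (C0≋0 u≈0)) (zeroʳ X))) ⟩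
      x + - 0#         ≈⟨ +-congˡ {x} ε⁻¹≈ε ⟩
      x + 0#           ≈⟨ +-identityʳ x ⟩
      x                ∎
      where
      open SetoidReasoning setoid
      open GroupProperties +-group using (ε⁻¹≈ε)

    0-XC≈-XC : ∀ {u} v → u R.≈ v → 0# - X * C u ≈ - (X * C v)
    0-XC≈-XC {u} v u≈v =
      trans (+-identityˡ (- (X * C u))) (-‿cong (*-congˡ {X} (C-cong u≈v)))

    x-XC+XC≈x : ∀ x {u} v → u R.≈ v → (x - X * C u) + X * C v ≈ x
    x-XC+XC≈x x {u} v u≈v = begin
      (x + - (X * C u)) + X * C v  ≈⟨ +-congˡ {x + - (X * C u)} (*-congˡ {X} (C-cong u≈v)) ⟨
      (x + - (X * C u)) + X * C u  ≈⟨ +-assoc x (- (X * C u)) (X * C u) ⟩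
      x + (- (X * C u) + X * C u)  ≈⟨ +-congˡ {x} (-‿inverseˡ (X * C u)) ⟩
      x + 0#                       ≈⟨ +-identityʳ x ⟩
      x                            ∎
      where open SetoidReasoning setoid

  -- The Toeplitz matrix: state 0 is deleted, and with it the only row changed by the boundary.
  interior : ∀ m → SquareMatrix m
  interior m i j = coefficientMatrix (suc m) (suc i) (suc j)

  E : ℕ → PowerSeries
  E m = det (interior m)

  E₁ : E 1 ≈ 1#
  E₁ = trans (det-headRow 0 (interior 1) (λ ()))
             (trans (*-identityʳ (interior 1 zero zero)) (x-0≈x 1# 0-weights))

  -- Up to size two the upper band lies outside the matrix, which is then unit lower triangular.
  E₂ : E 2 ≈ 1#
  E₂ = trans (det-headRow 1 (interior 2) (λ { zero → x-0≈x 0# 0-weights }))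
             (trans (*-cong (x-0≈x 1# 0-weights) E₁) (*-identityʳ 1#))

  banded : ∀ m → E (3 +ℕ m) + a * (b * b) * E m ≈ E (2 +ℕ m)
  banded m = det-banded m (interior (3 +ℕ m)) {a} {b}
    (x-0≈x 1# 0-weights) (x-0≈x 0# 0-weights) (0-XC≈-XC p p-weight) (λ _ → x-0≈x 0# 0-weights)
    (0-XC≈-XC q q-weight) (λ _ → x-0≈x 0# 0-weights)
    (0-XC≈-XC q q-weight) (λ _ → x-0≈x 0# 0-weights)

  -- Removing a chip from an empty pile stays at 0 and puts `- b` into the corner; in `interior` the
  -- corresponding move leaves the matrix.
  corner : ∀ m → D (suc m) + b * E m ≈ E (suc m)
  corner m = det-corner m (coefficientMatrix (suc m)) (interior (suc m)) {b}
    (trans (x-XC+XC≈x 1# q q-weight) (sym (x-0≈x 1# 0-weights)))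
    -- Elsewhere, raising both states by one leaves the entry unchanged by computation.
    (λ _ → refl) (λ _ _ → refl)

  open Corner a b D E refl refl E₁ E₂ corner banded public

  -- As `d (suc m)` is `D m`, this is the first claim of the theorem, and it also makes these series
  -- cancellable. The other terms of `d₂` and `recurrence` contain `X`.
  constantTerm : ∀ m → d (suc m) 0 R.≈ R.1#
  constantTerm zero = R.refl
  constantTerm (suc zero) = R.trans (R.trans (R.sym (R.+-identityʳ _))
    (R.+-congˡ (R.sym (X-⊛-zero (C q))))) (d₂ 0)
  constantTerm (suc (suc m)) = R.trans (R.trans (R.sym (R.+-identityʳ _))
    (R.+-congˡ (R.sym (vanish m)))) (R.trans (recurrence m 0) (constantTerm (suc m)))
    where
    vanish : ∀ m → (a * (b * b) * d m) 0 R.≈ R.0#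
    vanish m = R.trans (*-assoc a (b * b) (d m) 0) (XC-⊛-zero p (b * b * d m))

  -- The generating functions of the game.

  prob-false : ∀ k → prob k (λ _ → false) R.≈ R.0#
  prob-false zero    = R.refl
  prob-false (suc k) = R.trans
    (R.+-cong (R.trans (R.*-congˡ (prob-false k)) (R.zeroʳ p))
              (R.trans (R.*-congˡ (prob-false k)) (R.zeroʳ q)))
    (R.+-identityʳ R.0#)

  G-boundary : ∀ n s → n ≤ s → G n s ≈ 1#
  G-boundary n s n≤s zero rewrite dec-true (n ℕ.≤? s) n≤s = R.refl
  G-boundary n s n≤s (suc k) rewrite dec-false (s ℕ.<? n) (ℕ.≤⇒≯ n≤s) = prob-false (suc k)

  G-suc : ∀ n s k → s < n →
    G n s (suc k) R.≈ p R.* G n (2 +ℕ s) k R.+ q R.* G n (s ∸ 1) k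
  G-suc n s k s<n rewrite dec-true (s ℕ.<? n) s<n | ℕ.+-comm s 2 = R.refl

  -- First-step analysis, coefficient by coefficient. Truncated subtraction sends 0 to 0, so the
  -- boundary equation is included.
  G-system : ∀ n s → s < n → G n s ≈ a * G n (2 +ℕ s) + b * G n (s ∸ 1)
  G-system n s s<n zero rewrite dec-false (n ℕ.≤? s) (ℕ.<⇒≱ s<n) =
    R.sym (R.trans (R.+-cong (XC-⊛-zero p (G n (2 +ℕ s))) (XC-⊛-zero q (G n (s ∸ 1))))
                   (R.+-identityʳ R.0#))
  G-system n s s<n (suc k) = R.trans (G-suc n s k s<n)
    (R.sym (R.+-cong (XC-⊛-suc p (G n (2 +ℕ s)) k) (XC-⊛-suc q (G n (s ∸ 1)) k)))

  -- Polynomial numerators and the recurrence.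

  private
    d-cancelˡ : ∀ m x y → d (suc m) * x ≈ d (suc m) * y → x ≈ y
    d-cancelˡ m x y = ⊛-cancelˡ (d (suc m)) x y (constantTerm m)

    module Eliminated n = Elimination a b d refl refl d₂ recurrence d-cancelˡ
      n (G n) (G-system n)
    open Eliminated using (f; exit)

    a-polynomial : IsPolynomial a
    a-polynomial = IsPolynomial-⊛ {X} {C p} IsPolynomial-X (IsPolynomial-C p)

    b-polynomial : IsPolynomial b
    b-polynomial = IsPolynomial-⊛ {X} {C q} IsPolynomial-X (IsPolynomial-C q)

  d-recurrence : ∀ m → d (3 +ℕ m) ≈ d (2 +ℕ m) - a * (b * b) * d m
  d-recurrence m =
    x≈z//y (d (3 +ℕ m)) (a * (b * b) * d m) (d (2 +ℕ m)) (recurrence m)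

  d-polynomial : ∀ m → IsPolynomial (d m)
  d-polynomial zero = IsPolynomial-0
  d-polynomial (suc zero) = IsPolynomial-C R.1#
  d-polynomial (suc (suc zero)) = IsPolynomial-resp {1# - b} {d 2} (sym (x≈z//y (d 2) b 1# d₂))
    (IsPolynomial-⊕ {1#} { - b} (IsPolynomial-C R.1#) (IsPolynomial-⊖ {b} b-polynomial))
  d-polynomial (suc (suc (suc m))) =
    IsPolynomial-resp {d (2 +ℕ m) - a * (b * b) * d m} {d (3 +ℕ m)} (sym (d-recurrence m))
      (IsPolynomial-⊕ {d (2 +ℕ m)} { - (a * (b * b) * d m)} (d-polynomial (suc (suc m)))
        (IsPolynomial-⊖ {a * (b * b) * d m} (IsPolynomial-⊛ {a * (b * b)} {d m}
          (IsPolynomial-⊛ {a} {b * b} a-polynomial (IsPolynomial-⊛ {b} {b} b-polynomial b-polynomial))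
          (d-polynomial m))))

  f-polynomial : ∀ n s j → IsPolynomial (f n s j)
  f-polynomial n s 0 = IsPolynomial-0
  f-polynomial n s 1 = d-polynomial (suc s)
  f-polynomial n s 2 = IsPolynomial-⊛ {a * b} {d s}
    (IsPolynomial-⊛ {a} {b} a-polynomial b-polynomial) (d-polynomial s)
  f-polynomial n s (suc (suc (suc j))) =
    IsPolynomial-⊕ {a * f n s (suc j)} {a * a * b * f n s j}
      (IsPolynomial-⊛ {a} {f n s (suc j)} a-polynomial (f-polynomial n s (suc j)))
      (IsPolynomial-⊛ {a * a * b} {f n s j}
        (IsPolynomial-⊛ {a * a} {b} (IsPolynomial-⊛ {a} {a} a-polynomial a-polynomial) b-polynomial)
        (f-polynomial n s j))

  -- Once the exit point is `n`, both generating functions left in `exit` are at the boundary and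
  -- equal 1.
  numerator-polynomial : ∀ n s → s ≤ n → IsPolynomial (G n s * D n)
  numerator-polynomial n s s≤n = IsPolynomial-resp {f₁ + a * f₀} {G n s * D n} (sym equation)
    (IsPolynomial-⊕ {f₁} {a * f₀} (f-polynomial n s (suc j))
      (IsPolynomial-⊛ {a} {f₀} a-polynomial (f-polynomial n s j)))
    where
    open SetoidReasoning setoid
    j = n ∸ s
    f₀ = f n s j
    f₁ = f n s (suc j)

    j+s≡n : j +ℕ s ≡ n
    j+s≡n = ℕ.m∸n+n≡m s≤n

    equation : G n s * D n ≈ f₁ + a * f₀
    equation = begin
      G n s * D n
        ≈⟨ *-comm (G n s) (D n) ⟩
      D n * G n s
        ≡⟨ ≡.cong (λ m → D m * G n s) j+s≡n ⟨
      D (j +ℕ s) * G n s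
        ≈⟨ exit n s j (ℕ.≤-reflexive j+s≡n) ⟩
      f₁ * G n (j +ℕ s) + a * f₀ * G n (suc (j +ℕ s))
        ≈⟨ +-cong (*-congˡ {f₁} (G-boundary n (j +ℕ s) (ℕ.≤-reflexive (≡.sym j+s≡n))))
                  (*-congˡ {a * f₀} (G-boundary n (suc (j +ℕ s))
                    (ℕ.m≤n⇒m≤1+n (ℕ.≤-reflexive (≡.sym j+s≡n))))) ⟩
      f₁ * 1# + a * f₀ * 1#
        ≈⟨ +-cong (*-identityʳ f₁) (*-identityʳ (a * f₀)) ⟩
      f₁ + a * f₀ ∎

  D-recurrence : ∀ n → 3 ≤ n → D n ≈ D (n ∸ 1) - C p * C q ^ 2 * X ^ 3 * D (n ∸ 3)
  -- The argument `suc m` accounts for `d` being `D` shifted by one.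
  D-recurrence (suc (suc (suc m))) _ = trans (d-recurrence (suc m))
    (+-congˡ {D (2 +ℕ m)} (-‿cong (*-congʳ {D m} (cubic (C p) (C q) X))))
  D-recurrence (suc zero) (s≤s ())
  D-recurrence (suc (suc zero)) (s≤s (s≤s ()))

corollary13 : ∀ {c ℓ} (R : CommutativeRing c ℓ) (p : CommutativeRing.Carrier R) →
    let open PileGame R p
        module R = CommutativeRing R
    in (∀ n → D n 0 R.≈ R.1#)
       × (∃ λ (N : ℕ → ℕ → PowerSeries) →
            ∀ n s → s ≤ n → IsPolynomial (N n s) × G n s * D n ≈ N n s)
       × (∀ n → 3 ≤ n → D n ≈ D (n ∸ 1) - C p * C q ^ 2 * X ^ 3 * D (n ∸ 3))
corollary13 R p =
    constantTerm
  -- The numerator is taken to be the product itself, so all the content lies in its being a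
  -- polynomial.
  , ((λ n s → G n s * D n) , λ n s s≤n → numerator-polynomial n s s≤n , refl)
  , D-recurrence
  where
  open PileGame R p
  open PileGameProperties R p
  open CommutativeRing powerSeriesRing using (refl)
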